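{- Consider the orbits $\mathcal A[\mathbf v]$ of integer quadruples $\mathbf v$ with $Q_{\mathcal D}(\mathbf v)=4$. An orbit is exceptional if and only if it contains an element having a zero coordinate. There are exactly two exceptional orbits: one containing the two exceptional quadruples $(0,0,0,2)$ and $(0,0,0,-2)$, and the other containing the exceptional quadruple $(-1,0,0,1)$.
   Context: $Q_{\mathcal D}(a,b,c,d)=2(a^2+b^2+c^2+d^2)-(a+b+c+d)^2$; $L(\mathbf a)=a+b+c+d$; $|\mathbf a|=|a|+|b|+|c|+|d|$. $\mathbf S_i$ ($i=1,\dots,4$) is the integer matrix replacing the $i$-th coordinate $a_i$ of a quadruple by $2\sum_{j\ne i}a_j-a_i$, other coordinates fixed; the Apollonian group $\mathcal A$ is the subgroup of $GL(4,\mathbb Z)$ they generate, and $\mathcal A[\mathbf v]=\{\mathbf U\mathbf v:\mathbf U\in\mathcal A\}$. An integer quadruple is reduced if no $\mathbf S_i$ strictly decreases $|\cdot|$. A reduced quadruple ordered as $a\le b\le c\le d$ with $L\ge0$ is a root quadruple if $a+b+c\ge d>0$ and exceptional if $a+b+c\le 0<d$; a reduced quadruple with $L<0$ is root (resp. exceptional) iff $(-d,-c,-b,-a)$ is. An exceptional orbit is an orbit containing no root quadruple (equivalently, containing an exceptional quadruple).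
   Formalization: "Exactly two exceptional orbits" is counted up to one fixed permutation of the four coordinates: as literal orbits there are more, since (0,0,2,0) also has Q=4 and lies in an exceptional orbit different from those of (0,0,0,2) and (-1,0,0,1). -}

module Defs where

open import Level using (0ℓ)
open import Data.Nat as ℕ using (ℕ)
open import Data.Integer using (ℤ; +_; 0ℤ; 1ℤ; -1ℤ; _+_; _*_; _-_; -_; ∣_∣; _≤_; _<_)
open import Data.Fin using (Fin; zero; suc)
open import Data.Fin.Permutation using (Permutation′; _⟨$⟩ʳ_)
open import Data.Vec using (Vec; []; _∷_; map; zipWith; foldr′; transpose; lookup; tabulate)
open import Data.Product using (∃-syntax; _×_)
open import Data.Sum using (_⊎_)
open import Relation.Nullary using (¬_)
open import Relation.Unary using (Pred; _∈_; _≐_; _⊢_)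
open import Relation.Binary.PropositionalEquality using (_≡_)

Quadruple : Set
Quadruple = Vec ℤ 4

Q𝒟 : Quadruple → ℤ
Q𝒟 (a ∷ b ∷ c ∷ d ∷ []) =
  + 2 * (a * a + b * b + c * c + d * d) - (a + b + c + d) * (a + b + c + d)

L : Quadruple → ℤ
L (a ∷ b ∷ c ∷ d ∷ []) = a + b + c + d

norm : Quadruple → ℕ
norm (a ∷ b ∷ c ∷ d ∷ []) = ∣ a ∣ ℕ.+ ∣ b ∣ ℕ.+ ∣ c ∣ ℕ.+ ∣ d ∣

-- A matrix is the vector of its rows.
Matrix : Set
Matrix = Vec (Vec ℤ 4) 4

dot : Quadruple → Quadruple → ℤ
dot u v = foldr′ _+_ 0ℤ (zipWith _*_ u v)

infixr 8 _·_
_·_ : Matrix → Quadruple → Quadruple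
U · v = map (λ row → dot row v) U

infixr 8 _⊗_
_⊗_ : Matrix → Matrix → Matrix
U ⊗ V = map (λ row → map (dot row) (transpose V)) U

I : Matrix
I = (1ℤ ∷ 0ℤ ∷ 0ℤ ∷ 0ℤ ∷ [])
  ∷ (0ℤ ∷ 1ℤ ∷ 0ℤ ∷ 0ℤ ∷ [])
  ∷ (0ℤ ∷ 0ℤ ∷ 1ℤ ∷ 0ℤ ∷ [])
  ∷ (0ℤ ∷ 0ℤ ∷ 0ℤ ∷ 1ℤ ∷ []) ∷ []

S : Fin 4 → Matrix
S zero =
    (-1ℤ ∷ + 2 ∷ + 2 ∷ + 2 ∷ [])
  ∷ (0ℤ ∷ 1ℤ ∷ 0ℤ ∷ 0ℤ ∷ [])
  ∷ (0ℤ ∷ 0ℤ ∷ 1ℤ ∷ 0ℤ ∷ [])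
  ∷ (0ℤ ∷ 0ℤ ∷ 0ℤ ∷ 1ℤ ∷ []) ∷ []
S (suc zero) =
    (1ℤ ∷ 0ℤ ∷ 0ℤ ∷ 0ℤ ∷ [])
  ∷ (+ 2 ∷ -1ℤ ∷ + 2 ∷ + 2 ∷ [])
  ∷ (0ℤ ∷ 0ℤ ∷ 1ℤ ∷ 0ℤ ∷ [])
  ∷ (0ℤ ∷ 0ℤ ∷ 0ℤ ∷ 1ℤ ∷ []) ∷ []
S (suc (suc zero)) =
    (1ℤ ∷ 0ℤ ∷ 0ℤ ∷ 0ℤ ∷ [])
  ∷ (0ℤ ∷ 1ℤ ∷ 0ℤ ∷ 0ℤ ∷ [])
  ∷ (+ 2 ∷ + 2 ∷ -1ℤ ∷ + 2 ∷ [])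
  ∷ (0ℤ ∷ 0ℤ ∷ 0ℤ ∷ 1ℤ ∷ []) ∷ []
S (suc (suc (suc zero))) =
    (1ℤ ∷ 0ℤ ∷ 0ℤ ∷ 0ℤ ∷ [])
  ∷ (0ℤ ∷ 1ℤ ∷ 0ℤ ∷ 0ℤ ∷ [])
  ∷ (0ℤ ∷ 0ℤ ∷ 1ℤ ∷ 0ℤ ∷ [])
  ∷ (+ 2 ∷ + 2 ∷ + 2 ∷ -1ℤ ∷ []) ∷ []

-- The subgroup of GL(4,ℤ) generated by the S i.
data 𝒜 : Pred Matrix 0ℓ where
  gen : ∀ i → 𝒜 (S i)
  one : 𝒜 I
  mul : ∀ {U V} → 𝒜 U → 𝒜 V → 𝒜 (U ⊗ V)
  inv : ∀ {U V} → 𝒜 U → U ⊗ V ≡ I → V ⊗ U ≡ I → 𝒜 V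

𝒜[_] : Quadruple → Pred Quadruple 0ℓ
𝒜[ v ] w = ∃[ U ] U ∈ 𝒜 × w ≡ U · v

Reduced : Pred Quadruple 0ℓ
Reduced v = ∀ i → ¬ (norm (S i · v) ℕ.< norm v)

permute : Permutation′ 4 → Quadruple → Quadruple
permute π v = tabulate (λ i → lookup v (π ⟨$⟩ʳ i))

Ordered : Pred Quadruple 0ℓ
Ordered (a ∷ b ∷ c ∷ d ∷ []) = a ≤ b × b ≤ c × c ≤ d

negReverse : Quadruple → Quadruple
negReverse (a ∷ b ∷ c ∷ d ∷ []) = - d ∷ - c ∷ - b ∷ - a ∷ []

RootInequality : Pred Quadruple 0ℓ
RootInequality (a ∷ b ∷ c ∷ d ∷ []) = d ≤ a + b + c × 0ℤ < d

ExceptionalInequality : Pred Quadruple 0ℓ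
ExceptionalInequality (a ∷ b ∷ c ∷ d ∷ []) = a + b + c ≤ 0ℤ × 0ℤ < d

-- P is imposed on the increasing rearrangement w of the reduced quadruple v
-- when L w ≥ 0, and on (-d,-c,-b,-a) when w = (a,b,c,d) has L w < 0; the
-- latter is again reduced and increasing, with positive L.
ReducedWith : Pred Quadruple 0ℓ → Pred Quadruple 0ℓ
ReducedWith P v = Reduced v × (∃[ π ] let w = permute π v in
  Ordered w × ((0ℤ ≤ L w × P w) ⊎ (L w < 0ℤ × P (negReverse w))))

IsRoot : Pred Quadruple 0ℓ
IsRoot = ReducedWith RootInequality

IsExceptional : Pred Quadruple 0ℓ
IsExceptional = ReducedWith ExceptionalInequality

ExceptionalOrbit : Pred (Pred Quadruple 0ℓ) 0ℓ
ExceptionalOrbit O = ¬ (∃[ w ] w ∈ O × IsRoot w)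

HasZeroCoordinate : Pred Quadruple 0ℓ
HasZeroCoordinate v = ∃[ i ] lookup v i ≡ 0ℤ

-- Equality of orbits up to one fixed permutation of the coordinates.  Orbits
-- can only be counted in this sense: 𝒜 acts trivially modulo 2, so for
-- instance (0,0,0,2) and (0,0,2,0) lie in different 𝒜-orbits.
infix 4 _≐ᵖ_
_≐ᵖ_ : Pred Quadruple 0ℓ → Pred Quadruple 0ℓ → Set
O ≐ᵖ O′ = ∃[ π ] O ≐ (permute π ⊢ O′)

{-# OPTIONS --safe #-}

-- S i replaces vᵢ by 2 L(v) - 3 vᵢ.  If 2 vᵢ ≤ L(v) for all i and v has no zero entry, then
-- along a reduced word every generator creates a new positive maximal entry, so the orbit of
-- a root quadruple contains no zero entry.  Descent on the norm reaches a reduced quadruple;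
-- reflecting its largest entry shows that it is root or satisfies a + b + c ≤ 0, and in the
-- latter case Q𝒟 = L (L - 4 s) + 2 (a² + b² + c² + s²) with s = a + b + c, whose first
-- summand is nonnegative; this leaves only (0,0,0,2) and (-1,0,0,1).  Both are fixed modulo 4
-- by all generators, which separates their orbits and determines the exceptional quadruples
-- in each.
module Submission where

open import Defs
open import Level using (0ℓ)
import Algebra.Properties.CommutativeMonoid.Sum as Sum
open import Data.Empty using (⊥-elim)
open import Data.Fin using (Fin; toℕ)
open import Data.Fin.Patterns
import Data.Fin.Properties as Fin
open import Data.Fin.Permutation as Perm using (Permutation′; _⟨$⟩ʳ_; _⟨$⟩ˡ_; _∘ₚ_)
open import Data.Integer using (ℤ; +_; +[1+_]; -[1+_]; 0ℤ; 1ℤ; -1ℤ; _+_; _*_; _-_; -_; ∣_∣; _≤_; _<_; +≤+; -≤+; +<+; -<+)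
open import Data.Integer.Properties
open import Data.Integer.Divisibility.Signed using (_∣_; divides; _∣?_; ∣m∣n⇒∣m+n; ∣m∣n⇒∣m-n; ∣n⇒∣m*n)
open import Data.Integer.Tactic.RingSolver using (solve-∀)
open import Data.List using (List; []; _∷_; _++_; _∷ʳ_; reverse)
open import Data.List.Properties using (unfold-reverse)
import Data.Nat as ℕ
import Data.Nat.Properties as ℕ
open import Data.Nat.Induction using (<-wellFounded)
import Data.Nat.Tactic.RingSolver as ℕSolver
open import Data.Product using (∃-syntax; _×_; _,_; proj₁; proj₂)
open import Data.Sum using (_⊎_; inj₁; inj₂; [_,_]′)
open import Data.Vec using (Vec; []; _∷_; map; transpose; lookup; _[_]≔_)
open import Data.Vec.Properties using (lookup∘tabulate; tabulate∘lookup; tabulate-cong; lookup-map; map-∘; map-cong; lookup∘update; lookup∘update′; ≡-dec)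
open import Function using (_∘_; _⇔_; mk⇔)
open import Induction.WellFounded using (Acc; acc)
open import Relation.Nullary using (¬_; yes; no; Dec; ¬?; contradiction; _⊎-dec_; _→-dec_)
open import Relation.Nullary.Decidable using (from-yes; from-no)
open import Relation.Unary using (Pred; _∈_; _≐_; _∩_; _∪_; ｛_｝)
open import Relation.Binary.PropositionalEquality

-- Quadruples and the generators

lookup-ext : ∀ {u v : Quadruple} → (∀ i → lookup u i ≡ lookup v i) → u ≡ v
lookup-ext {u} {v} u≗v =
  trans (sym (tabulate∘lookup u)) (trans (tabulate-cong u≗v) (tabulate∘lookup v))

dot-unit : ∀ j v → dot (lookup I j) v ≡ lookup v j
dot-unit j (a ∷ b ∷ c ∷ d ∷ []) = row j a b c d
  where
  row : ∀ j a b c d → dot (lookup I j) (a ∷ b ∷ c ∷ d ∷ []) ≡ lookup (a ∷ b ∷ c ∷ d ∷ []) j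
  row 0F = row₀
    where
    row₀ : ∀ a b c d → 1ℤ * a + (0ℤ * b + (0ℤ * c + (0ℤ * d + 0ℤ))) ≡ a
    row₀ = solve-∀
  row 1F = row₁
    where
    row₁ : ∀ a b c d → 0ℤ * a + (1ℤ * b + (0ℤ * c + (0ℤ * d + 0ℤ))) ≡ b
    row₁ = solve-∀
  row 2F = row₂
    where
    row₂ : ∀ a b c d → 0ℤ * a + (0ℤ * b + (1ℤ * c + (0ℤ * d + 0ℤ))) ≡ c
    row₂ = solve-∀
  row 3F = row₃
    where
    row₃ : ∀ a b c d → 0ℤ * a + (0ℤ * b + (0ℤ * c + (1ℤ * d + 0ℤ))) ≡ d
    row₃ = solve-∀

lookup-· : ∀ U v i → lookup (U · v) i ≡ dot (lookup U i) v
lookup-· U v i = lookup-map i (λ row → dot row v) U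

I-· : ∀ v → I · v ≡ v
I-· v = lookup-ext λ i → trans (lookup-· I v i) (dot-unit i v)

-- Row form of associativity, (rV)x = r(Vx); with all entries as variables it is a single ring
-- identity.
dot-⊗ : ∀ r V x → dot (map (dot r) (transpose V)) x ≡ dot r (V · x)
dot-⊗ (r₁ ∷ r₂ ∷ r₃ ∷ r₄ ∷ [])
  ((a₁ ∷ a₂ ∷ a₃ ∷ a₄ ∷ []) ∷ (b₁ ∷ b₂ ∷ b₃ ∷ b₄ ∷ []) ∷
   (c₁ ∷ c₂ ∷ c₃ ∷ c₄ ∷ []) ∷ (d₁ ∷ d₂ ∷ d₃ ∷ d₄ ∷ []) ∷ [])
  (x₁ ∷ x₂ ∷ x₃ ∷ x₄ ∷ []) =
  exchange r₁ r₂ r₃ r₄ a₁ a₂ a₃ a₄ b₁ b₂ b₃ b₄ c₁ c₂ c₃ c₄ d₁ d₂ d₃ d₄ x₁ x₂ x₃ x₄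
  where
  exchange : ∀ r₁ r₂ r₃ r₄ a₁ a₂ a₃ a₄ b₁ b₂ b₃ b₄ c₁ c₂ c₃ c₄ d₁ d₂ d₃ d₄ x₁ x₂ x₃ x₄ →
    (r₁ * a₁ + (r₂ * b₁ + (r₃ * c₁ + (r₄ * d₁ + 0ℤ)))) * x₁ +
    ((r₁ * a₂ + (r₂ * b₂ + (r₃ * c₂ + (r₄ * d₂ + 0ℤ)))) * x₂ +
    ((r₁ * a₃ + (r₂ * b₃ + (r₃ * c₃ + (r₄ * d₃ + 0ℤ)))) * x₃ +
    ((r₁ * a₄ + (r₂ * b₄ + (r₃ * c₄ + (r₄ * d₄ + 0ℤ)))) * x₄ + 0ℤ)))
    ≡ r₁ * (a₁ * x₁ + (a₂ * x₂ + (a₃ * x₃ + (a₄ * x₄ + 0ℤ)))) +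
     (r₂ * (b₁ * x₁ + (b₂ * x₂ + (b₃ * x₃ + (b₄ * x₄ + 0ℤ)))) +
     (r₃ * (c₁ * x₁ + (c₂ * x₂ + (c₃ * x₃ + (c₄ * x₄ + 0ℤ)))) +
     (r₄ * (d₁ * x₁ + (d₂ * x₂ + (d₃ * x₃ + (d₄ * x₄ + 0ℤ)))) + 0ℤ)))
  exchange = solve-∀

⊗-· : ∀ U V v → (U ⊗ V) · v ≡ U · (V · v)
⊗-· U V v = trans (sym (map-∘ (λ row → dot row v) (λ row → map (dot row) (transpose V)) U))
                  (map-cong (λ row → dot-⊗ row V v) U)

lookup-S-≢ : ∀ {i j} v → j ≢ i → lookup (S i · v) j ≡ lookup v j
lookup-S-≢ {i} {j} v j≢i = begin
  lookup (S i · v) j    ≡⟨ lookup-· (S i) v j ⟩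
  dot (lookup (S i) j) v ≡⟨ cong (λ row → dot row v) (unitRow i j j≢i) ⟩
  dot (lookup I j) v    ≡⟨ dot-unit j v ⟩
  lookup v j            ∎
  where
  open ≡-Reasoning
  unitRow : ∀ i j → j ≢ i → lookup (S i) j ≡ lookup I j
  unitRow = from-yes (Fin.all? λ i → Fin.all? λ j →
    ¬? (j Fin.≟ i) →-dec ≡-dec _≟_ (lookup (S i) j) (lookup I j))

lookup-S : ∀ i v → lookup (S i · v) i ≡ + 2 * L v - + 3 * lookup v i
lookup-S 0F (a ∷ b ∷ c ∷ d ∷ []) = eq a b c d
  where
  eq : ∀ a b c d → -1ℤ * a + (+ 2 * b + (+ 2 * c + (+ 2 * d + 0ℤ))) ≡ + 2 * (a + b + c + d) - + 3 * a
  eq = solve-∀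
lookup-S 1F (a ∷ b ∷ c ∷ d ∷ []) = eq a b c d
  where
  eq : ∀ a b c d → + 2 * a + (-1ℤ * b + (+ 2 * c + (+ 2 * d + 0ℤ))) ≡ + 2 * (a + b + c + d) - + 3 * b
  eq = solve-∀
lookup-S 2F (a ∷ b ∷ c ∷ d ∷ []) = eq a b c d
  where
  eq : ∀ a b c d → + 2 * a + (+ 2 * b + (-1ℤ * c + (+ 2 * d + 0ℤ))) ≡ + 2 * (a + b + c + d) - + 3 * c
  eq = solve-∀
lookup-S 3F (a ∷ b ∷ c ∷ d ∷ []) = eq a b c d
  where
  eq : ∀ a b c d → + 2 * a + (+ 2 * b + (+ 2 * c + (-1ℤ * d + 0ℤ))) ≡ + 2 * (a + b + c + d) - + 3 * d
  eq = solve-∀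

-- Factors a generator through the replacement of one coordinate, so that `L`, `∑²` and `norm` need
-- only be tracked under `v [ i ]≔ x`.
S-update : ∀ i v → S i · v ≡ v [ i ]≔ (+ 2 * L v - + 3 * lookup v i)
S-update i v = lookup-ext coordinate
  where
  coordinate : ∀ j → lookup (S i · v) j ≡ lookup (v [ i ]≔ (+ 2 * L v - + 3 * lookup v i)) j
  coordinate j with j Fin.≟ i
  ... | yes refl = trans (lookup-S i v) (sym (lookup∘update i v _))
  ... | no j≢i   = trans (lookup-S-≢ v j≢i) (sym (lookup∘update′ j≢i v _))

-- The forms and the norm under a change of one coordinate

∑ : Quadruple → ℤ
∑ v = Sum.sum +-0-commutativeMonoid (lookup v)

-- Like `∑`, written as a sum over an index set, so that invariance under permutations of the
-- coordinates is an instance of `Sum.sum-permute`.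
∑² : Quadruple → ℤ
∑² v = Sum.sum +-0-commutativeMonoid (λ i → lookup v i * lookup v i)

L≡∑ : ∀ v → L v ≡ ∑ v
L≡∑ (a ∷ b ∷ c ∷ d ∷ []) = eq a b c d
  where
  eq : ∀ a b c d → a + b + c + d ≡ a + (b + (c + (d + 0ℤ)))
  eq = solve-∀

Q𝒟≡∑ : ∀ v → Q𝒟 v ≡ + 2 * ∑² v - L v * L v
Q𝒟≡∑ (a ∷ b ∷ c ∷ d ∷ []) = eq a b c d
  where
  eq : ∀ a b c d → + 2 * (a * a + b * b + c * c + d * d) - (a + b + c + d) * (a + b + c + d) ≡
    + 2 * (a * a + (b * b + (c * c + (d * d + 0ℤ)))) - (a + b + c + d) * (a + b + c + d)
  eq = solve-∀

L-update : ∀ i v x → L (v [ i ]≔ x) ≡ L v - lookup v i + x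
L-update 0F (a ∷ b ∷ c ∷ d ∷ []) = eq a b c d
  where
  eq : ∀ a b c d x → x + b + c + d ≡ a + b + c + d - a + x
  eq = solve-∀
L-update 1F (a ∷ b ∷ c ∷ d ∷ []) = eq a b c d
  where
  eq : ∀ a b c d x → a + x + c + d ≡ a + b + c + d - b + x
  eq = solve-∀
L-update 2F (a ∷ b ∷ c ∷ d ∷ []) = eq a b c d
  where
  eq : ∀ a b c d x → a + b + x + d ≡ a + b + c + d - c + x
  eq = solve-∀
L-update 3F (a ∷ b ∷ c ∷ d ∷ []) = eq a b c d
  where
  eq : ∀ a b c d x → a + b + c + x ≡ a + b + c + d - d + x
  eq = solve-∀

∑²-update : ∀ i v x → ∑² (v [ i ]≔ x) ≡ ∑² v - lookup v i * lookup v i + x * x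
∑²-update 0F (a ∷ b ∷ c ∷ d ∷ []) = eq a b c d
  where
  eq : ∀ a b c d x → x * x + (b * b + (c * c + (d * d + 0ℤ))) ≡
    a * a + (b * b + (c * c + (d * d + 0ℤ))) - a * a + x * x
  eq = solve-∀
∑²-update 1F (a ∷ b ∷ c ∷ d ∷ []) = eq a b c d
  where
  eq : ∀ a b c d x → a * a + (x * x + (c * c + (d * d + 0ℤ))) ≡
    a * a + (b * b + (c * c + (d * d + 0ℤ))) - b * b + x * x
  eq = solve-∀
∑²-update 2F (a ∷ b ∷ c ∷ d ∷ []) = eq a b c d
  where
  eq : ∀ a b c d x → a * a + (b * b + (x * x + (d * d + 0ℤ))) ≡
    a * a + (b * b + (c * c + (d * d + 0ℤ))) - c * c + x * x
  eq = solve-∀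
∑²-update 3F (a ∷ b ∷ c ∷ d ∷ []) = eq a b c d
  where
  eq : ∀ a b c d x → a * a + (b * b + (c * c + (x * x + 0ℤ))) ≡
    a * a + (b * b + (c * c + (d * d + 0ℤ))) - d * d + x * x
  eq = solve-∀

-- Moving both absolute values to the positive side avoids truncated subtraction of natural numbers.
norm-update : ∀ i v x → norm (v [ i ]≔ x) ℕ.+ ∣ lookup v i ∣ ≡ norm v ℕ.+ ∣ x ∣
norm-update 0F (a ∷ b ∷ c ∷ d ∷ []) x = eq (∣ a ∣) (∣ b ∣) (∣ c ∣) (∣ d ∣) (∣ x ∣)
  where
  eq : ∀ a b c d x → x ℕ.+ b ℕ.+ c ℕ.+ d ℕ.+ a ≡ a ℕ.+ b ℕ.+ c ℕ.+ d ℕ.+ x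
  eq = ℕSolver.solve-∀
norm-update 1F (a ∷ b ∷ c ∷ d ∷ []) x = eq (∣ a ∣) (∣ b ∣) (∣ c ∣) (∣ d ∣) (∣ x ∣)
  where
  eq : ∀ a b c d x → a ℕ.+ x ℕ.+ c ℕ.+ d ℕ.+ b ≡ a ℕ.+ b ℕ.+ c ℕ.+ d ℕ.+ x
  eq = ℕSolver.solve-∀
norm-update 2F (a ∷ b ∷ c ∷ d ∷ []) x = eq (∣ a ∣) (∣ b ∣) (∣ c ∣) (∣ d ∣) (∣ x ∣)
  where
  eq : ∀ a b c d x → a ℕ.+ b ℕ.+ x ℕ.+ d ℕ.+ c ≡ a ℕ.+ b ℕ.+ c ℕ.+ d ℕ.+ x
  eq = ℕSolver.solve-∀
norm-update 3F (a ∷ b ∷ c ∷ d ∷ []) x = eq (∣ a ∣) (∣ b ∣) (∣ c ∣) (∣ d ∣) (∣ x ∣)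
  where
  eq : ∀ a b c d x → a ℕ.+ b ℕ.+ c ℕ.+ x ℕ.+ d ≡ a ℕ.+ b ℕ.+ c ℕ.+ d ℕ.+ x
  eq = ℕSolver.solve-∀

L-S : ∀ i v → L (S i · v) ≡ + 3 * L v - + 4 * lookup v i
L-S i v = begin
  L (S i · v)                                            ≡⟨ cong L (S-update i v) ⟩
  L (v [ i ]≔ _)                                         ≡⟨ L-update i v _ ⟩
  L v - lookup v i + (+ 2 * L v - + 3 * lookup v i)      ≡⟨ eq (L v) (lookup v i) ⟩
  + 3 * L v - + 4 * lookup v i                           ∎
  where
  open ≡-Reasoning
  eq : ∀ l x → l - x + (+ 2 * l - + 3 * x) ≡ + 3 * l - + 4 * x
  eq = solve-∀

-- With the other coordinates fixed, `Q𝒟` is a monic quadratic in the `i`-th coordinate whose linear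
-- coefficient is minus twice their sum; `S i` exchanges the two solutions of `Q𝒟` = constant.
Q𝒟-S : ∀ i v → Q𝒟 (S i · v) ≡ Q𝒟 v
Q𝒟-S i v = begin
  Q𝒟 (S i · v)
    ≡⟨ Q𝒟≡∑ (S i · v) ⟩
  + 2 * ∑² (S i · v) - L (S i · v) * L (S i · v)
    ≡⟨ cong₂ (λ p l → + 2 * p - l * l) (trans (cong ∑² (S-update i v)) (∑²-update i v _)) (L-S i v) ⟩
  + 2 * (∑² v - x * x + (+ 2 * L v - + 3 * x) * (+ 2 * L v - + 3 * x)) - (+ 3 * L v - + 4 * x) * (+ 3 * L v - + 4 * x)
    ≡⟨ eq (∑² v) (L v) x ⟩
  + 2 * ∑² v - L v * L v
    ≡⟨ Q𝒟≡∑ v ⟨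
  Q𝒟 v ∎
  where
  open ≡-Reasoning
  x = lookup v i
  eq : ∀ p l x → + 2 * (p - x * x + (+ 2 * l - + 3 * x) * (+ 2 * l - + 3 * x)) -
    (+ 3 * l - + 4 * x) * (+ 3 * l - + 4 * x) ≡ + 2 * p - l * l
  eq = solve-∀

S-involutive : ∀ i v → S i · (S i · v) ≡ v
S-involutive i v = lookup-ext coordinate
  where
  open ≡-Reasoning
  eq : ∀ l x → + 2 * (+ 3 * l - + 4 * x) - + 3 * (+ 2 * l - + 3 * x) ≡ x
  eq = solve-∀
  coordinate : ∀ j → lookup (S i · (S i · v)) j ≡ lookup v j
  coordinate j with j Fin.≟ i
  ... | no j≢i   = trans (lookup-S-≢ (S i · v) j≢i) (lookup-S-≢ v j≢i)
  ... | yes refl = begin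
    lookup (S i · (S i · v)) i                         ≡⟨ lookup-S i (S i · v) ⟩
    + 2 * L (S i · v) - + 3 * lookup (S i · v) i       ≡⟨ cong₂ (λ l x → + 2 * l - + 3 * x) (L-S i v) (lookup-S i v) ⟩
    _                                                  ≡⟨ eq (L v) (lookup v i) ⟩
    lookup v i                                         ∎

-- Negation

negate : Quadruple → Quadruple
negate = map (-_)

L-neg : ∀ v → L (negate v) ≡ - L v
L-neg (a ∷ b ∷ c ∷ d ∷ []) = eq a b c d
  where
  eq : ∀ a b c d → - a + - b + - c + - d ≡ - (a + b + c + d)
  eq = solve-∀

Q𝒟-neg : ∀ v → Q𝒟 (negate v) ≡ Q𝒟 v
Q𝒟-neg (a ∷ b ∷ c ∷ d ∷ []) = eq a b c d
  where
  eq : ∀ a b c d → + 2 * (- a * - a + - b * - b + - c * - c + - d * - d) - (- a + - b + - c + - d) * (- a + - b + - c + - d) ≡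
    + 2 * (a * a + b * b + c * c + d * d) - (a + b + c + d) * (a + b + c + d)
  eq = solve-∀

S-neg : ∀ i v → S i · negate v ≡ negate (S i · v)
S-neg i v = lookup-ext coordinate
  where
  open ≡-Reasoning
  eq : ∀ l x → + 2 * - l - + 3 * - x ≡ - (+ 2 * l - + 3 * x)
  eq = solve-∀
  coordinate : ∀ j → lookup (S i · negate v) j ≡ lookup (negate (S i · v)) j
  coordinate j with j Fin.≟ i
  ... | no j≢i   = begin
    lookup (S i · negate v) j  ≡⟨ lookup-S-≢ (negate v) j≢i ⟩
    lookup (negate v) j        ≡⟨ lookup-map j (-_) v ⟩
    - lookup v j               ≡⟨ cong (-_) (lookup-S-≢ v j≢i) ⟨
    - lookup (S i · v) j       ≡⟨ lookup-map j (-_) (S i · v) ⟨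
    lookup (negate (S i · v)) j ∎
  ... | yes refl = begin
    lookup (S i · negate v) i                    ≡⟨ lookup-S i (negate v) ⟩
    + 2 * L (negate v) - + 3 * lookup (negate v) i
                                                 ≡⟨ cong₂ (λ l x → + 2 * l - + 3 * x) (L-neg v) (lookup-map i (-_) v) ⟩
    + 2 * - L v - + 3 * - lookup v i             ≡⟨ eq (L v) (lookup v i) ⟩
    - (+ 2 * L v - + 3 * lookup v i)             ≡⟨ cong (-_) (lookup-S i v) ⟨
    - lookup (S i · v) i                         ≡⟨ lookup-map i (-_) (S i · v) ⟨
    lookup (negate (S i · v)) i                  ∎

-- Permutations of the coordinates

lookup-permute : ∀ π v i → lookup (permute π v) i ≡ lookup v (π ⟨$⟩ʳ i)
lookup-permute π v = lookup∘tabulate _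

lookup-permute⁻¹ : ∀ π v i → lookup (permute π v) (π ⟨$⟩ˡ i) ≡ lookup v i
lookup-permute⁻¹ π v i = trans (lookup-permute π v _) (cong (lookup v) (Perm.inverseʳ π))

permute-∘ : ∀ π ρ v → permute ρ (permute π v) ≡ permute (ρ ∘ₚ π) v
permute-∘ π ρ v = tabulate-cong λ i → lookup-permute π v (ρ ⟨$⟩ʳ i)

permute-flip : ∀ π v → permute (Perm.flip π) (permute π v) ≡ v
permute-flip π v = lookup-ext λ i → trans (lookup-permute (Perm.flip π) (permute π v) i) (lookup-permute⁻¹ π v i)

L-permute : ∀ π v → L (permute π v) ≡ L v
L-permute π v = begin
  L (permute π v)  ≡⟨ L≡∑ (permute π v) ⟩
  ∑ (permute π v)  ≡⟨ Sum.sum-cong-≗ +-0-commutativeMonoid (lookup-permute π v) ⟩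
  _                ≡⟨ Sum.sum-permute +-0-commutativeMonoid (lookup v) π ⟨
  ∑ v              ≡⟨ L≡∑ v ⟨
  L v              ∎
  where open ≡-Reasoning

Q𝒟-permute : ∀ π v → Q𝒟 (permute π v) ≡ Q𝒟 v
Q𝒟-permute π v = begin
  Q𝒟 (permute π v)
    ≡⟨ Q𝒟≡∑ (permute π v) ⟩
  + 2 * ∑² (permute π v) - L (permute π v) * L (permute π v)
    ≡⟨ cong₂ (λ p l → + 2 * p - l * l) ∑²-permute (L-permute π v) ⟩
  + 2 * ∑² v - L v * L v
    ≡⟨ Q𝒟≡∑ v ⟨
  Q𝒟 v ∎
  where
  open ≡-Reasoning
  ∑²-permute : ∑² (permute π v) ≡ ∑² v
  ∑²-permute = trans
    (Sum.sum-cong-≗ +-0-commutativeMonoid λ i → cong (λ x → x * x) (lookup-permute π v i))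
    (sym (Sum.sum-permute +-0-commutativeMonoid (λ i → lookup v i * lookup v i) π))

-- Since `permute π` reads through `π ⟨$⟩ʳ`, the old coordinate `i` sits at place `π ⟨$⟩ˡ i`. Hence
-- relabelling conjugates generators into generators and carries orbits to orbits.
S-permute : ∀ π i v → permute π (S i · v) ≡ S (π ⟨$⟩ˡ i) · permute π v
S-permute π i v = lookup-ext coordinate
  where
  open ≡-Reasoning
  coordinate : ∀ j → lookup (permute π (S i · v)) j ≡ lookup (S (π ⟨$⟩ˡ i) · permute π v) j
  coordinate j with j Fin.≟ (π ⟨$⟩ˡ i)
  ... | no j≢k = begin
    lookup (permute π (S i · v)) j              ≡⟨ lookup-permute π (S i · v) j ⟩
    lookup (S i · v) (π ⟨$⟩ʳ j)                 ≡⟨ lookup-S-≢ v (λ eq → j≢k (trans (sym (Perm.inverseˡ π)) (cong (π ⟨$⟩ˡ_) eq))) ⟩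
    lookup v (π ⟨$⟩ʳ j)                         ≡⟨ lookup-permute π v j ⟨
    lookup (permute π v) j                      ≡⟨ lookup-S-≢ (permute π v) j≢k ⟨
    lookup (S (π ⟨$⟩ˡ i) · permute π v) j       ∎
  ... | yes refl = begin
    lookup (permute π (S i · v)) j                           ≡⟨ lookup-permute⁻¹ π (S i · v) i ⟩
    lookup (S i · v) i                                       ≡⟨ lookup-S i v ⟩
    + 2 * L v - + 3 * lookup v i                             ≡⟨ cong₂ (λ l x → + 2 * l - + 3 * x) (L-permute π v) (lookup-permute⁻¹ π v i) ⟨
    + 2 * L (permute π v) - + 3 * lookup (permute π v) j     ≡⟨ lookup-S j (permute π v) ⟨
    lookup (S j · permute π v) j                             ∎

-- Sorting four integers

Sortable : Pred Quadruple 0ℓ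
Sortable v = ∃[ π ] Ordered (permute π v)

sortable-permute : ∀ π v → Sortable (permute π v) → Sortable v
sortable-permute π v (ρ , ordered) = ρ ∘ₚ π , subst Ordered (permute-∘ π ρ v) ordered

-- Merge sort: `sort₀` and `sort₁` order the two pairs, `sort₂` puts the pair with the smaller
-- minimum first, and `sort₃` inserts `b` into `c ≤ d`.
sortable : ∀ v → Sortable v
sortable (a ∷ b ∷ c ∷ d ∷ []) = sort₀ a b c d
  where
  swap : Fin 4 → Fin 4 → Permutation′ 4
  swap = Perm.transpose

  sort₃ : ∀ a b c d → a ≤ b → c ≤ d → a ≤ c → Sortable (a ∷ b ∷ c ∷ d ∷ [])
  sort₃ a b c d a≤b c≤d a≤c with ≤-total b d | ≤-total b c
  ... | inj₂ d≤b | _        = sortable-permute (swap 1F 2F) (a ∷ b ∷ c ∷ d ∷ [])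
                                (sortable-permute (swap 2F 3F) (a ∷ c ∷ b ∷ d ∷ [])
                                  (Perm.id , a≤c , c≤d , d≤b))
  ... | inj₁ b≤d | inj₁ b≤c = Perm.id , a≤b , b≤c , c≤d
  ... | inj₁ b≤d | inj₂ c≤b = sortable-permute (swap 1F 2F) (a ∷ b ∷ c ∷ d ∷ [])
                                (Perm.id , a≤c , c≤b , b≤d)

  sort₂ : ∀ a b c d → a ≤ b → c ≤ d → Sortable (a ∷ b ∷ c ∷ d ∷ [])
  sort₂ a b c d a≤b c≤d with ≤-total a c
  ... | inj₁ a≤c = sort₃ a b c d a≤b c≤d a≤c
  ... | inj₂ c≤a = sortable-permute (swap 0F 2F) (a ∷ b ∷ c ∷ d ∷ [])
                     (sortable-permute (swap 1F 3F) (c ∷ b ∷ a ∷ d ∷ [])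
                       (sort₃ c d a b c≤d a≤b c≤a))

  sort₁ : ∀ a b c d → a ≤ b → Sortable (a ∷ b ∷ c ∷ d ∷ [])
  sort₁ a b c d a≤b with ≤-total c d
  ... | inj₁ c≤d = sort₂ a b c d a≤b c≤d
  ... | inj₂ d≤c = sortable-permute (swap 2F 3F) (a ∷ b ∷ c ∷ d ∷ []) (sort₂ a b d c a≤b d≤c)

  sort₀ : ∀ a b c d → Sortable (a ∷ b ∷ c ∷ d ∷ [])
  sort₀ a b c d with ≤-total a b
  ... | inj₁ a≤b = sort₁ a b c d a≤b
  ... | inj₂ b≤a = sortable-permute (swap 0F 1F) (a ∷ b ∷ c ∷ d ∷ []) (sort₁ b a c d b≤a)

-- Orbits

act : List (Fin 4) → Quadruple → Quadruple
act []       v = v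
act (i ∷ is) v = S i · act is v

act-++ : ∀ is js v → act (is ++ js) v ≡ act is (act js v)
act-++ []       js v = refl
act-++ (i ∷ is) js v = cong (S i ·_) (act-++ is js v)

act-reverse : ∀ is v → act (reverse is) (act is v) ≡ v
act-reverse []       v = refl
act-reverse (i ∷ is) v = begin
  act (reverse (i ∷ is)) (act (i ∷ is) v)          ≡⟨ cong (λ w → act w (act (i ∷ is) v)) (unfold-reverse i is) ⟩
  act (reverse is ∷ʳ i) (act (i ∷ is) v)           ≡⟨ act-++ (reverse is) (i ∷ []) _ ⟩
  act (reverse is) (S i · (S i · act is v))        ≡⟨ cong (act (reverse is)) (S-involutive i (act is v)) ⟩
  act (reverse is) (act is v)                      ≡⟨ act-reverse is v ⟩
  v                                                ∎
  where open ≡-Reasoning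

act-reverse′ : ∀ is v → act is (act (reverse is) v) ≡ v
act-reverse′ []       v = refl
act-reverse′ (i ∷ is) v = begin
  S i · act is (act (reverse (i ∷ is)) v)     ≡⟨ cong (λ w → S i · act is (act w v)) (unfold-reverse i is) ⟩
  S i · act is (act (reverse is ∷ʳ i) v)      ≡⟨ cong (λ u → S i · act is u) (act-++ (reverse is) (i ∷ []) v) ⟩
  S i · act is (act (reverse is) (S i · v))   ≡⟨ cong (S i ·_) (act-reverse′ is (S i · v)) ⟩
  S i · (S i · v)                             ≡⟨ S-involutive i v ⟩
  v                                           ∎
  where open ≡-Reasoning

-- For `inv`, the generators are involutions, so the reversed word inverts the action of `U`, and
-- `V ⊗ U ≡ I` identifies the action of `V` with it.
word : ∀ {U} → U ∈ 𝒜 → ∃[ is ] (∀ v → U · v ≡ act is v)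
word (gen i) = i ∷ [] , λ v → refl
word one     = [] , I-·
word (mul {U} {V} U∈𝒜 V∈𝒜) with word U∈𝒜 | word V∈𝒜
... | is , U≗is | js , V≗js = is ++ js , λ v → begin
  (U ⊗ V) · v         ≡⟨ ⊗-· U V v ⟩
  U · (V · v)         ≡⟨ cong (U ·_) (V≗js v) ⟩
  U · act js v        ≡⟨ U≗is (act js v) ⟩
  act is (act js v)   ≡⟨ act-++ is js v ⟨
  act (is ++ js) v    ∎
  where open ≡-Reasoning
word (inv {U} {V} U∈𝒜 _ VU≡I) with word U∈𝒜
... | is , U≗is = reverse is , λ v → begin
  V · v                               ≡⟨ cong (V ·_) (act-reverse′ is v) ⟨
  V · act is (act (reverse is) v)     ≡⟨ cong (V ·_) (U≗is _) ⟨
  V · (U · act (reverse is) v)        ≡⟨ ⊗-· V U _ ⟨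
  (V ⊗ U) · act (reverse is) v        ≡⟨ cong (_· act (reverse is) v) VU≡I ⟩
  I · act (reverse is) v              ≡⟨ I-· _ ⟩
  act (reverse is) v                  ∎
  where open ≡-Reasoning

orbit⇒word : ∀ {v w} → w ∈ 𝒜[ v ] → ∃[ is ] (w ≡ act is v)
orbit⇒word {v} (U , U∈𝒜 , refl) = proj₁ (word U∈𝒜) , proj₂ (word U∈𝒜) v

orbit-refl : ∀ {v} → v ∈ 𝒜[ v ]
orbit-refl {v} = I , one , sym (I-· v)

orbit-S : ∀ {v w} i → w ∈ 𝒜[ v ] → S i · w ∈ 𝒜[ v ]
orbit-S {v} i (U , U∈𝒜 , refl) = S i ⊗ U , mul (gen i) U∈𝒜 , sym (⊗-· (S i) U v)

act∈orbit : ∀ is v → act is v ∈ 𝒜[ v ]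
act∈orbit []       v = orbit-refl
act∈orbit (i ∷ is) v = orbit-S i (act∈orbit is v)

orbit-trans : ∀ {u v w} → w ∈ 𝒜[ v ] → v ∈ 𝒜[ u ] → w ∈ 𝒜[ u ]
orbit-trans {u} (U , U∈𝒜 , refl) (V , V∈𝒜 , refl) = U ⊗ V , mul U∈𝒜 V∈𝒜 , sym (⊗-· U V u)

orbit-sym : ∀ {v w} → w ∈ 𝒜[ v ] → v ∈ 𝒜[ w ]
orbit-sym {v} w∈ with orbit⇒word w∈
... | is , refl = subst (_∈ 𝒜[ act is v ]) (act-reverse is v) (act∈orbit (reverse is) (act is v))

-- Every matrix of the group acts as a word, so a property need only be preserved by the four
-- generators.
orbit-induction : (P : Pred Quadruple 0ℓ) → (∀ i v → P v → P (S i · v)) → ∀ {v w} → w ∈ 𝒜[ v ] → P v → P w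
orbit-induction P P-S {v} w∈ Pv with orbit⇒word w∈
... | is , refl = along is
  where
  along : ∀ is → P (act is v)
  along []       = Pv
  along (i ∷ is) = P-S i (act is v) (along is)

orbit-Q𝒟 : ∀ {v w k} → w ∈ 𝒜[ v ] → Q𝒟 v ≡ k → Q𝒟 w ≡ k
orbit-Q𝒟 = orbit-induction (λ u → Q𝒟 u ≡ _) λ i v eq → trans (Q𝒟-S i v) eq

orbit-permute : ∀ π {v w} → w ∈ 𝒜[ v ] → permute π w ∈ 𝒜[ permute π v ]
orbit-permute π {v} w∈ = orbit-induction (λ u → permute π u ∈ 𝒜[ permute π v ])
  (λ i u u∈ → subst (_∈ 𝒜[ permute π v ]) (sym (S-permute π i u)) (orbit-S (π ⟨$⟩ˡ i) u∈))
  w∈ orbit-refl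

orbit-neg : ∀ {v w} → w ∈ 𝒜[ v ] → negate w ∈ 𝒜[ negate v ]
orbit-neg {v} w∈ = orbit-induction (λ u → negate u ∈ 𝒜[ negate v ])
  (λ i u u∈ → subst (_∈ 𝒜[ negate v ]) (S-neg i u) (orbit-S i u∈)) w∈ orbit-refl

-- A permutation carries orbits to orbits, and orbits are equivalence classes, so one corresponding
-- pair of points suffices.
orbit-≐ᵖ : ∀ {u v e} π → u ∈ 𝒜[ v ] → permute π u ∈ 𝒜[ e ] → 𝒜[ v ] ≐ᵖ 𝒜[ e ]
orbit-≐ᵖ {u} {v} {e} π u∈ πu∈ = π ,
  (λ w∈ → orbit-trans (orbit-permute π (orbit-trans w∈ (orbit-sym u∈))) πu∈) ,
  (λ {w} πw∈ → orbit-trans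
    (subst₂ (λ x y → x ∈ 𝒜[ y ]) (permute-flip π w) (permute-flip π u)
      (orbit-permute (Perm.flip π) (orbit-trans πw∈ (orbit-sym πu∈))))
    u∈)

-- Orbits of root quadruples

0≤+ : ∀ {x y} → 0ℤ ≤ x → 0ℤ ≤ y → 0ℤ ≤ x + y
0≤+ = +-mono-≤

0≤* : ∀ {x y} → 0ℤ ≤ x → 0ℤ ≤ y → 0ℤ ≤ x * y
0≤* {+ m} {+ n} _ _ = subst (0ℤ ≤_) (pos-* m n) (+≤+ ℕ.z≤n)

0≤x*x : ∀ x → 0ℤ ≤ x * x
0≤x*x (+ n)    = subst (0ℤ ≤_) (pos-* n n) (+≤+ ℕ.z≤n)
0≤x*x -[1+ n ] = +≤+ ℕ.z≤n

halve-0≤ : ∀ {x} → 0ℤ ≤ + 2 * x → 0ℤ ≤ x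
halve-0≤ {x} = *-cancelˡ-≤-pos 0ℤ x (+ 2)

-- The root inequality in a form free of any ordering: no entry exceeds the sum of the other three.
Balanced : Pred Quadruple 0ℓ
Balanced v = (∀ i → 0ℤ ≤ L v - (lookup v i + lookup v i)) × 0ℤ < L v

balanced-permute : ∀ π v → Balanced v → Balanced (permute π v)
balanced-permute π v (gap , 0<L) =
  (λ i → subst₂ (λ l x → 0ℤ ≤ l - (x + x)) (sym (L-permute π v)) (sym (lookup-permute π v i)) (gap (π ⟨$⟩ʳ i))) ,
  subst (0ℤ <_) (sym (L-permute π v)) 0<L

balanced-permute⁻¹ : ∀ π v → Balanced (permute π v) → Balanced v
balanced-permute⁻¹ π v = subst Balanced (permute-flip π v) ∘ balanced-permute (Perm.flip π) (permute π v)

root-balanced : ∀ w → Ordered w → RootInequality w → Balanced w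
root-balanced (a ∷ b ∷ c ∷ d ∷ []) (a≤b , b≤c , c≤d) (d≤a+b+c , 0<d) = gap , 0<L
  where
  l = a + b + c + d
  top : 0ℤ ≤ l - (d + d)
  top = subst (0ℤ ≤_) (eq a b c d) (i≤j⇒0≤j-i d≤a+b+c)
    where
    eq : ∀ a b c d → a + b + c - d ≡ a + b + c + d - (d + d)
    eq = solve-∀
  below : ∀ {x} → x ≤ d → 0ℤ ≤ l - (x + x)
  below {x} x≤d = subst (0ℤ ≤_) (eq l x d) (0≤+ top (0≤+ (i≤j⇒0≤j-i x≤d) (i≤j⇒0≤j-i x≤d)))
    where
    eq : ∀ l x d → l - (d + d) + (d - x + (d - x)) ≡ l - (x + x)
    eq = solve-∀
  gap : ∀ i → 0ℤ ≤ l - (lookup (a ∷ b ∷ c ∷ d ∷ []) i + lookup (a ∷ b ∷ c ∷ d ∷ []) i)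
  gap 0F = below (≤-trans a≤b (≤-trans b≤c c≤d))
  gap 1F = below (≤-trans b≤c c≤d)
  gap 2F = below c≤d
  gap 3F = top
  0<L : 0ℤ < l
  0<L = subst (0ℤ <_) (eq l d) (+-mono-≤-< top (+-mono-< 0<d 0<d))
    where
    eq : ∀ l d → l - (d + d) + (d + d) ≡ l
    eq = solve-∀

negReverse-permute : ∀ w → negReverse w ≡ permute Perm.reverse (negate w)
negReverse-permute (a ∷ b ∷ c ∷ d ∷ []) = refl

negate-permute : ∀ π v → negate (permute π v) ≡ permute π (negate v)
negate-permute π v = lookup-ext λ i → begin
  lookup (negate (permute π v)) i   ≡⟨ lookup-map i (-_) (permute π v) ⟩
  - lookup (permute π v) i          ≡⟨ cong (-_) (lookup-permute π v i) ⟩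
  - lookup v (π ⟨$⟩ʳ i)             ≡⟨ lookup-map (π ⟨$⟩ʳ i) (-_) v ⟨
  lookup (negate v) (π ⟨$⟩ʳ i)      ≡⟨ lookup-permute π (negate v) i ⟨
  lookup (permute π (negate v)) i   ∎
  where open ≡-Reasoning

ordered-negReverse : ∀ w → Ordered w → Ordered (negReverse w)
ordered-negReverse (a ∷ b ∷ c ∷ d ∷ []) (a≤b , b≤c , c≤d) = neg-mono-≤ c≤d , neg-mono-≤ b≤c , neg-mono-≤ a≤b

L-negReverse : ∀ w → L (negReverse w) ≡ - L w
L-negReverse w = trans (cong L (negReverse-permute w)) (trans (L-permute Perm.reverse (negate w)) (L-neg w))

Q𝒟-negReverse : ∀ w → Q𝒟 (negReverse w) ≡ Q𝒟 w
Q𝒟-negReverse w = trans (cong Q𝒟 (negReverse-permute w)) (trans (Q𝒟-permute Perm.reverse (negate w)) (Q𝒟-neg w))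

isRoot⇒balanced : ∀ {v} → IsRoot v → Balanced v ⊎ Balanced (negate v)
isRoot⇒balanced {v} (_ , π , ordered , inj₁ (_ , root)) =
  inj₁ (balanced-permute⁻¹ π v (root-balanced (permute π v) ordered root))
isRoot⇒balanced {v} (_ , π , ordered , inj₂ (_ , root)) =
  inj₂ (balanced-permute⁻¹ π (negate v) (subst Balanced (negate-permute π v)
    (balanced-permute⁻¹ Perm.reverse (negate (permute π v))
      (root-balanced (negReverse (permute π v)) (ordered-negReverse (permute π v) ordered) root))))

-- Absence of zero entries along the orbit of a root

NonVanishing : Pred Quadruple 0ℓ
NonVanishing v = ∀ i → lookup v i ≢ 0ℤ

-- With x = L - 2b, y = L - 2c, z = L - 2d, the form restricted to a = 0 is -(xy + yz + zx).
balanced-nonVanishing : ∀ v → Q𝒟 v ≡ + 4 → Balanced v → NonVanishing v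
balanced-nonVanishing v Q≡4 balanced i vᵢ≡0 =
  first (permute π v) (trans (Q𝒟-permute π v) Q≡4) (proj₁ (balanced-permute π v balanced))
    (trans (lookup-permute π v 0F) vᵢ≡0)
  where
  π = Perm.transpose 0F i
  first : ∀ w → Q𝒟 w ≡ + 4 → (∀ j → 0ℤ ≤ L w - (lookup w j + lookup w j)) → lookup w 0F ≢ 0ℤ
  first (.0ℤ ∷ b ∷ c ∷ d ∷ []) Q≡4 gap refl =
    contradiction (subst (0ℤ ≤_) (trans (eq b c d) (cong (-_) Q≡4))
      (0≤+ (0≤+ (0≤* (gap 1F) (gap 2F)) (0≤* (gap 2F) (gap 3F))) (0≤* (gap 3F) (gap 1F)))) λ ()
    where
    eq : ∀ b c d →
      (0ℤ + b + c + d - (b + b)) * (0ℤ + b + c + d - (c + c)) +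
      (0ℤ + b + c + d - (c + c)) * (0ℤ + b + c + d - (d + d)) +
      (0ℤ + b + c + d - (d + d)) * (0ℤ + b + c + d - (b + b)) ≡
      - (+ 2 * (0ℤ * 0ℤ + b * b + c * c + d * d) - (0ℤ + b + c + d) * (0ℤ + b + c + d))
    eq = solve-∀

-- The part of `Balanced` that survives reflection: L - 2vᵢ changes sign under `S i`, but if it was
-- nonnegative then all bounds on pairs persist.
PairBounded : Pred Quadruple 0ℓ
PairBounded v = ∀ {i j} → i ≢ j → 0ℤ ≤ L v - (lookup v i + lookup v j)

-- The invariant carried along a reduced word, with `k` the coordinate reflected last.
record Peak (k : Fin 4) (v : Quadruple) : Set where
  field
    maximal      : ∀ j → 0ℤ ≤ lookup v k - lookup v j
    positive     : 0ℤ < lookup v k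
    pairBounded  : PairBounded v
    nonVanishing : NonVanishing v

balanced-pairBounded : ∀ v → Balanced v → PairBounded v
balanced-pairBounded v (gap , _) {i} {j} _ =
  halve-0≤ (subst (0ℤ ≤_) (eq (L v) (lookup v i) (lookup v j)) (0≤+ (gap i) (gap j)))
  where
  eq : ∀ l x y → l - (x + x) + (l - (y + y)) ≡ + 2 * (l - (x + y))
  eq = solve-∀

-- Each new quantity is a sum of old nonnegative ones. The new entry is (l - 2x) + (l - x), and it
-- exceeds another entry y by (l - 2x) + (l - (x + y)). Its pair bound with y is the old l - (x +
-- y), and a pair avoiding `i` gains 2(l - 2x).
S-peak : ∀ i v → 0ℤ ≤ L v - (lookup v i + lookup v i) → 0ℤ < L v - lookup v i →
  PairBounded v → NonVanishing v → Peak i (S i · v)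
S-peak i v gap 0<L-x pair nonzero = record
  { maximal = maximal ; positive = positive ; pairBounded = pairBounded ; nonVanishing = nonVanishing }
  where
  l = L v
  x = lookup v i
  positive : 0ℤ < lookup (S i · v) i
  positive = subst (0ℤ <_) (trans (eq l x) (sym (lookup-S i v))) (+-mono-≤-< gap 0<L-x)
    where
    eq : ∀ l x → l - (x + x) + (l - x) ≡ + 2 * l - + 3 * x
    eq = solve-∀
  maximal : ∀ j → 0ℤ ≤ lookup (S i · v) i - lookup (S i · v) j
  maximal j with j Fin.≟ i
  ... | yes refl = i≤j⇒0≤j-i (≤-refl {lookup (S i · v) i})
  ... | no j≢i   = subst (0ℤ ≤_)
    (trans (eq l x (lookup v j)) (sym (cong₂ _-_ (lookup-S i v) (lookup-S-≢ v j≢i))))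
    (0≤+ gap (pair (j≢i ∘ sym)))
    where
    eq : ∀ l x y → l - (x + x) + (l - (x + y)) ≡ + 2 * l - + 3 * x - y
    eq = solve-∀
  withPeak : ∀ {j} → j ≢ i → 0ℤ ≤ L (S i · v) - (lookup (S i · v) i + lookup (S i · v) j)
  withPeak {j} j≢i = subst (0ℤ ≤_)
    (trans (eq l x (lookup v j)) (sym (cong₂ _-_ (L-S i v) (cong₂ _+_ (lookup-S i v) (lookup-S-≢ v j≢i)))))
    (pair (j≢i ∘ sym))
    where
    eq : ∀ l x y → l - (x + y) ≡ + 3 * l - + 4 * x - (+ 2 * l - + 3 * x + y)
    eq = solve-∀
  pairBounded : PairBounded (S i · v)
  pairBounded {p} {q} p≢q with p Fin.≟ i | q Fin.≟ i
  ... | yes refl | _        = withPeak (p≢q ∘ sym)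
  ... | no p≢i   | yes refl = subst (λ s → 0ℤ ≤ L (S i · v) - s)
    (+-comm (lookup (S i · v) i) (lookup (S i · v) p)) (withPeak p≢i)
  ... | no p≢i   | no q≢i   = subst (0ℤ ≤_)
    (trans (eq l x (lookup v p) (lookup v q))
      (sym (cong₂ _-_ (L-S i v) (cong₂ _+_ (lookup-S-≢ v p≢i) (lookup-S-≢ v q≢i)))))
    (0≤+ (pair p≢q) (0≤+ gap gap))
    where
    eq : ∀ l x y z → l - (y + z) + (l - (x + x) + (l - (x + x))) ≡ + 3 * l - + 4 * x - (y + z)
    eq = solve-∀
  nonVanishing : NonVanishing (S i · v)
  nonVanishing j with j Fin.≟ i
  ... | yes refl = λ eq → <-irrefl (sym eq) positive
  ... | no j≢i   = λ eq → nonzero j (trans (sym (lookup-S-≢ v j≢i)) eq)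

-- The part of the Cayley tree above a balanced quadruple: each vertex remembers the
-- generator leading back to its parent, and every other generator creates a new peak.
data Tree : Pred Quadruple 0ℓ where
  root : ∀ {v} → Balanced v → NonVanishing v → Tree v
  node : ∀ {v} k → Tree v → Peak k (S k · v) → Tree (S k · v)

-- At a `node`, reflecting in `k` again returns to the stored parent. For `i ≢ k` the hypotheses of
-- `S-peak` follow from the peak m: L - 2x = (m - x) + (L - (m + x)) and L - x = (L - (m + x)) + m.
tree-S : ∀ i v → Tree v → Tree (S i · v)
tree-S i v t@(root balanced@(gap , 0<L) nonzero) =
  node i t (S-peak i v (gap i) 0<L-x (balanced-pairBounded v balanced) nonzero)
  where
  eq : ∀ l x → l - (x + x) + l ≡ (l - x) + (l - x)
  eq = solve-∀
  -- Twice L - x equals (L - 2x) + L, which is positive.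
  0<L-x : 0ℤ < L v - lookup v i
  0<L-x = ≰⇒> λ L-x≤0 → <-irrefl refl (<-≤-trans
    (subst (0ℤ <_) (eq (L v) (lookup v i)) (+-mono-≤-< (gap i) 0<L)) (+-mono-≤ L-x≤0 L-x≤0))
tree-S i _ t@(node {v} k parent peak) with i Fin.≟ k
... | yes refl = subst Tree (sym (S-involutive i v)) parent
... | no i≢k   = node i t (S-peak i w
    (subst (0ℤ ≤_) (eq₁ (L w) (lookup w k) (lookup w i)) (0≤+ (maximal i) (pairBounded (i≢k ∘ sym))))
    (subst (0ℤ <_) (eq₂ (L w) (lookup w k) (lookup w i)) (+-mono-≤-< (pairBounded (i≢k ∘ sym)) positive))
    pairBounded nonVanishing)
  where
  open Peak peak
  w = S k · v
  eq₁ : ∀ l m x → m - x + (l - (m + x)) ≡ l - (x + x)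
  eq₁ = solve-∀
  eq₂ : ∀ l m x → l - (m + x) + m ≡ l - x
  eq₂ = solve-∀

tree-nonVanishing : ∀ {v} → Tree v → NonVanishing v
tree-nonVanishing (root _ nonzero)  = nonzero
tree-nonVanishing (node _ _ peak)   = Peak.nonVanishing peak

balanced-orbit : ∀ {v w} → Q𝒟 v ≡ + 4 → Balanced v → w ∈ 𝒜[ v ] → NonVanishing w
balanced-orbit {v} Q≡4 balanced w∈ = tree-nonVanishing
  (orbit-induction Tree tree-S w∈ (root balanced (balanced-nonVanishing v Q≡4 balanced)))

root-orbit : ∀ {v w} → Q𝒟 v ≡ + 4 → IsRoot v → w ∈ 𝒜[ v ] → NonVanishing w
root-orbit {v} {w} Q≡4 isRoot w∈ i wᵢ≡0 with isRoot⇒balanced isRoot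
... | inj₁ balanced = balanced-orbit Q≡4 balanced w∈ i wᵢ≡0
... | inj₂ balanced = balanced-orbit (trans (Q𝒟-neg v) Q≡4) balanced (orbit-neg w∈) i
  (trans (lookup-map i (-_) w) (cong (-_) wᵢ≡0))

zero⇒exceptionalOrbit : ∀ {v w} → Q𝒟 v ≡ + 4 → w ∈ 𝒜[ v ] → HasZeroCoordinate w → ExceptionalOrbit 𝒜[ v ]
zero⇒exceptionalOrbit Q≡4 w∈ (i , wᵢ≡0) (u , u∈ , isRoot) =
  root-orbit (orbit-Q𝒟 u∈ Q≡4) isRoot (orbit-trans w∈ (orbit-sym u∈)) i wᵢ≡0

-- Reduced quadruples

-- `S i` changes only the `i`-th summand of the norm, so reducedness compares that summand with its
-- reflection.
reduced-coordinate : ∀ {v} → Reduced v → ∀ i → ∣ lookup v i ∣ ℕ.≤ ∣ + 2 * L v - + 3 * lookup v i ∣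
reduced-coordinate {v} reduced i = ℕ.+-cancelˡ-≤ (norm v) _ _ (begin
  norm v ℕ.+ ∣ lookup v i ∣             ≤⟨ ℕ.+-monoˡ-≤ ∣ lookup v i ∣ (ℕ.≮⇒≥ (reduced i)) ⟩
  norm (S i · v) ℕ.+ ∣ lookup v i ∣     ≡⟨ cong (λ u → norm u ℕ.+ ∣ lookup v i ∣) (S-update i v) ⟩
  norm (v [ i ]≔ x) ℕ.+ ∣ lookup v i ∣  ≡⟨ norm-update i v x ⟩
  norm v ℕ.+ ∣ x ∣                      ∎)
  where
  open ℕ.≤-Reasoning
  x = + 2 * L v - + 3 * lookup v i

-- The two signs of y = 2l - 3x: y - x = 2(l - 2x), while -y - x = 2(x - l). For x = d and l = a + b
-- + c + d the alternatives read d ≤ a + b + c and a + b + c ≤ 0.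
reflection-dichotomy : ∀ l x → 0ℤ ≤ x → ∣ x ∣ ℕ.≤ ∣ + 2 * l - + 3 * x ∣ → 0ℤ ≤ l - (x + x) ⊎ 0ℤ ≤ x - l
reflection-dichotomy l (+ n) _ n≤ with ≤-total 0ℤ (+ 2 * l - + 3 * + n)
... | inj₁ 0≤y = inj₁ (halve-0≤ (subst (0ℤ ≤_) (eq l (+ n))
  (i≤j⇒0≤j-i (≤-trans (+≤+ n≤) (≤-reflexive (0≤i⇒+∣i∣≡i 0≤y))))))
  where
  eq : ∀ l x → + 2 * l - + 3 * x - x ≡ + 2 * (l - (x + x))
  eq = solve-∀
... | inj₂ y≤0 = inj₂ (halve-0≤ (subst (0ℤ ≤_) (eq l (+ n))
  (i≤j⇒0≤j-i (≤-trans (+≤+ n≤) (≤-reflexive ∣y∣≡-y)))))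
  where
  y = + 2 * l - + 3 * + n
  eq : ∀ l x → - (+ 2 * l - + 3 * x) - x ≡ + 2 * (x - l)
  eq = solve-∀
  ∣y∣≡-y : + ∣ y ∣ ≡ - y
  ∣y∣≡-y = trans (cong +_ (sym (∣-i∣≡∣i∣ y))) (0≤i⇒+∣i∣≡i (neg-mono-≤ y≤0))

-- If d ≤ 0, all entries are nonpositive with nonnegative sum, hence zero, and `Q𝒟` would be 0.
ordered-positive : ∀ w → Ordered w → 0ℤ ≤ L w → Q𝒟 w ≡ + 4 → 0ℤ < lookup w 3F
ordered-positive (a ∷ b ∷ c ∷ d ∷ []) (a≤b , b≤c , c≤d) 0≤L Q≡4 = ≰⇒> λ d≤0 →
  let c≤0 = ≤-trans c≤d d≤0
      b≤0 = ≤-trans b≤c c≤0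
      a≤0 = ≤-trans a≤b b≤0
      0≤a = subst (0ℤ ≤_) (eq a b c d)
              (0≤+ 0≤L (0≤+ (neg-mono-≤ b≤0) (0≤+ (neg-mono-≤ c≤0) (neg-mono-≤ d≤0))))
      0≤b = ≤-trans 0≤a a≤b
      0≤c = ≤-trans 0≤b b≤c
      0≤d = ≤-trans 0≤c c≤d
  in allZero (≤-antisym a≤0 0≤a) (≤-antisym b≤0 0≤b) (≤-antisym c≤0 0≤c) (≤-antisym d≤0 0≤d) Q≡4
  where
  eq : ∀ a b c d → a + b + c + d + (- b + (- c + - d)) ≡ a
  eq = solve-∀
  allZero : ∀ {a b c d} → a ≡ 0ℤ → b ≡ 0ℤ → c ≡ 0ℤ → d ≡ 0ℤ → Q𝒟 (a ∷ b ∷ c ∷ d ∷ []) ≢ + 4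
  allZero refl refl refl refl ()

reduced-dichotomy : ∀ w → Ordered w → 0ℤ ≤ L w → Q𝒟 w ≡ + 4 →
  ∣ lookup w 3F ∣ ℕ.≤ ∣ + 2 * L w - + 3 * lookup w 3F ∣ → RootInequality w ⊎ ExceptionalInequality w
reduced-dichotomy w@(a ∷ b ∷ c ∷ d ∷ []) ordered 0≤L Q≡4 d≤ with ordered-positive w ordered 0≤L Q≡4
... | 0<d with reflection-dichotomy (a + b + c + d) d (<⇒≤ 0<d) d≤
...   | inj₁ gap = inj₁ (0≤i-j⇒j≤i (subst (0ℤ ≤_) (eq a b c d) gap) , 0<d)
  where
  eq : ∀ a b c d → a + b + c + d - (d + d) ≡ a + b + c - d
  eq = solve-∀
...   | inj₂ gap = inj₂ (0≤i-j⇒j≤i (subst (0ℤ ≤_) (eq a b c d) gap) , 0<d)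
  where
  eq : ∀ a b c d → d - (a + b + c + d) ≡ 0ℤ - (a + b + c)
  eq = solve-∀

reduced-root-or-exceptional : ∀ v → Reduced v → Q𝒟 v ≡ + 4 → IsRoot v ⊎ IsExceptional v
reduced-root-or-exceptional v reduced Q≡4 with sortable v
... | π , ordered with 0ℤ ≤? L (permute π v)
...   | yes 0≤L = [ (λ r → inj₁ (reduced , π , ordered , inj₁ (0≤L , r)))
                  , (λ e → inj₂ (reduced , π , ordered , inj₁ (0≤L , e))) ]′
  (reduced-dichotomy (permute π v) ordered 0≤L (trans (Q𝒟-permute π v) Q≡4)
    (subst (λ l → ∣ x ∣ ℕ.≤ ∣ + 2 * l - + 3 * x ∣) (sym (L-permute π v)) (reduced-coordinate reduced (π ⟨$⟩ʳ 3F))))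
  where x = lookup v (π ⟨$⟩ʳ 3F)
...   | no 0≰L = [ (λ r → inj₁ (reduced , π , ordered , inj₂ (L<0 , r)))
                 , (λ e → inj₂ (reduced , π , ordered , inj₂ (L<0 , e))) ]′
  (reduced-dichotomy (negReverse w) (ordered-negReverse w ordered)
    (subst (0ℤ ≤_) (sym (L-negReverse w)) (neg-mono-≤ (<⇒≤ L<0)))
    (trans (Q𝒟-negReverse w) (trans (Q𝒟-permute π v) Q≡4))
    -- The largest entry of `negReverse w` is minus the first entry of `w`, so reducedness is used
    -- at `π ⟨$⟩ʳ 0F`.
    (subst₂ ℕ._≤_ (sym (∣-i∣≡∣i∣ x)) (sym reflected) (reduced-coordinate reduced (π ⟨$⟩ʳ 0F))))
  where
  w = permute π v
  x = lookup v (π ⟨$⟩ʳ 0F)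
  L<0 : L w < 0ℤ
  L<0 = ≰⇒> 0≰L
  eq : ∀ l x → + 2 * - l - + 3 * - x ≡ - (+ 2 * l - + 3 * x)
  eq = solve-∀
  open ≡-Reasoning
  reflected : ∣ + 2 * L (negReverse w) - + 3 * - x ∣ ≡ ∣ + 2 * L v - + 3 * x ∣
  reflected = begin
    ∣ + 2 * L (negReverse w) - + 3 * - x ∣   ≡⟨ cong (λ l → ∣ + 2 * l - + 3 * - x ∣) (L-negReverse w) ⟩
    ∣ + 2 * - L w - + 3 * - x ∣              ≡⟨ cong ∣_∣ (eq (L w) x) ⟩
    ∣ - (+ 2 * L w - + 3 * x) ∣              ≡⟨ ∣-i∣≡∣i∣ (+ 2 * L w - + 3 * x) ⟩
    ∣ + 2 * L w - + 3 * x ∣                  ≡⟨ cong (λ l → ∣ + 2 * l - + 3 * x ∣) (L-permute π v) ⟩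
    ∣ + 2 * L v - + 3 * x ∣                  ∎

reduction : ∀ v → ∃[ u ] (u ∈ 𝒜[ v ] × Reduced u)
reduction v = descend v (<-wellFounded (norm v))
  where
  descend : ∀ v → Acc ℕ._<_ (norm v) → ∃[ u ] (u ∈ 𝒜[ v ] × Reduced u)
  descend v (acc smaller) with Fin.any? (λ i → norm (S i · v) ℕ.<? norm v)
  ... | no stuck      = v , orbit-refl , λ i decrease → stuck (i , decrease)
  ... | yes (i , decrease) with descend (S i · v) (smaller decrease)
  ...   | u , u∈ , reduced = u , orbit-trans u∈ (orbit-S i orbit-refl) , reduced

-- Exceptional quadruples

e₁ e₁′ e₂ : Quadruple
e₁  = 0ℤ ∷ 0ℤ ∷ 0ℤ ∷ + 2 ∷ []
e₁′ = 0ℤ ∷ 0ℤ ∷ 0ℤ ∷ -[1+ 1 ] ∷ []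
e₂  = -1ℤ ∷ 0ℤ ∷ 0ℤ ∷ 1ℤ ∷ []

-- Lists -1, 0, 1, so that the remaining triples can be settled by a finite search.
unit : Fin 3 → ℤ
unit k = + toℕ k - 1ℤ

square-large : ∀ n → ¬ ((2 ℕ.+ n) ℕ.* (2 ℕ.+ n) ℕ.≤ 2)
square-large n h = from-no (4 ℕ.≤? 2) (ℕ.≤-trans (ℕ.*-mono-≤ (ℕ.m≤m+n 2 n) (ℕ.m≤m+n 2 n)) h)

x*x≤2⇒unit : ∀ x → x * x ≤ + 2 → ∃[ k ] (x ≡ unit k)
x*x≤2⇒unit (+ 0)               _ = 1F , refl
x*x≤2⇒unit (+ 1)               _ = 2F , refl
x*x≤2⇒unit -[1+ 0 ]            _ = 0F , refl
x*x≤2⇒unit +[1+ ℕ.suc n ]      h = ⊥-elim (square-large n (drop‿+≤+ h))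
x*x≤2⇒unit -[1+ ℕ.suc n ]      h = ⊥-elim (square-large n (drop‿+≤+ h))

sumOfSquares : ℤ → ℤ → ℤ → ℤ
sumOfSquares a b c = a * a + b * b + c * c + (a + b + c) * (a + b + c)

-- The triples (a, b, c) that survive the search; the third is excluded only once d is considered.
Candidate : Pred (Vec ℤ 3) 0ℓ
Candidate t = t ≡ 0ℤ ∷ 0ℤ ∷ 0ℤ ∷ [] ⊎ t ≡ -1ℤ ∷ 0ℤ ∷ 0ℤ ∷ [] ⊎ t ≡ -1ℤ ∷ 0ℤ ∷ 1ℤ ∷ []

candidate? : ∀ t → Dec (Candidate t)
candidate? t = ≡-dec _≟_ t _ ⊎-dec (≡-dec _≟_ t _ ⊎-dec ≡-dec _≟_ t _)

units-candidate : ∀ i j k → let a = unit i; b = unit j; c = unit k in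
  a ≤ b → b ≤ c → a + b + c ≤ 0ℤ → sumOfSquares a b c ≤ + 2 → Candidate (a ∷ b ∷ c ∷ [])
units-candidate = from-yes (Fin.all? λ i → Fin.all? λ j → Fin.all? λ k →
  let a = unit i; b = unit j; c = unit k in
  a ≤? b →-dec (b ≤? c →-dec (a + b + c ≤? 0ℤ →-dec
    (sumOfSquares a b c ≤? + 2 →-dec candidate? (a ∷ b ∷ c ∷ [])))))

-- Both factors in L (L - 4s) = 4 - 2 `sumOfSquares a b c`, where s = a + b + c, are nonnegative.
-- The resulting bound is free of d, which makes the search finite.
exceptional-sumOfSquares : ∀ a b c d → a + b + c ≤ 0ℤ → 0ℤ ≤ a + b + c + d →
  Q𝒟 (a ∷ b ∷ c ∷ d ∷ []) ≡ + 4 → 0ℤ ≤ + 2 - sumOfSquares a b c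
exceptional-sumOfSquares a b c d s≤0 0≤L Q≡4 = halve-0≤ (subst (0ℤ ≤_)
  (trans (eq a b c d) (trans (cong (_- + 2 * sumOfSquares a b c) Q≡4) (eq′ (sumOfSquares a b c))))
  (0≤* 0≤L (0≤+ 0≤L (0≤* (+≤+ (ℕ.z≤n {4})) (neg-mono-≤ s≤0)))))
  where
  eq : ∀ a b c d →
    (a + b + c + d) * (a + b + c + d + + 4 * - (a + b + c)) ≡
    + 2 * (a * a + b * b + c * c + d * d) - (a + b + c + d) * (a + b + c + d) -
    + 2 * (a * a + b * b + c * c + (a + b + c) * (a + b + c))
  eq = solve-∀
  eq′ : ∀ x → + 4 - + 2 * x ≡ + 2 * (+ 2 - x)
  eq′ = solve-∀

exceptional-ordered : ∀ w → Ordered w → 0ℤ ≤ L w → Q𝒟 w ≡ + 4 → ExceptionalInequality w → w ≡ e₁ ⊎ w ≡ e₂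
exceptional-ordered (a ∷ b ∷ c ∷ d ∷ []) (a≤b , b≤c , c≤d) 0≤L Q≡4 (s≤0 , _) =
  complete a b c (candidate a b c unitA unitB unitC a≤b b≤c s≤0 (0≤i-j⇒j≤i bound)) c≤d 0≤L Q≡4
  where
  bound = exceptional-sumOfSquares a b c d s≤0 0≤L Q≡4
  unitA : ∃[ k ] (a ≡ unit k)
  unitA = x*x≤2⇒unit a (0≤i-j⇒j≤i (subst (0ℤ ≤_) (eq (a * a) (b * b) (c * c) ((a + b + c) * (a + b + c)))
    (0≤+ bound (0≤+ (0≤x*x b) (0≤+ (0≤x*x c) (0≤x*x (a + b + c)))))))
    where
    eq : ∀ x y z t → + 2 - (x + y + z + t) + (y + (z + t)) ≡ + 2 - x
    eq = solve-∀
  unitB : ∃[ k ] (b ≡ unit k)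
  unitB = x*x≤2⇒unit b (0≤i-j⇒j≤i (subst (0ℤ ≤_) (eq (a * a) (b * b) (c * c) ((a + b + c) * (a + b + c)))
    (0≤+ bound (0≤+ (0≤x*x a) (0≤+ (0≤x*x c) (0≤x*x (a + b + c)))))))
    where
    eq : ∀ x y z t → + 2 - (x + y + z + t) + (x + (z + t)) ≡ + 2 - y
    eq = solve-∀
  unitC : ∃[ k ] (c ≡ unit k)
  unitC = x*x≤2⇒unit c (0≤i-j⇒j≤i (subst (0ℤ ≤_) (eq (a * a) (b * b) (c * c) ((a + b + c) * (a + b + c)))
    (0≤+ bound (0≤+ (0≤x*x a) (0≤+ (0≤x*x b) (0≤x*x (a + b + c)))))))
    where
    eq : ∀ x y z t → + 2 - (x + y + z + t) + (x + (y + t)) ≡ + 2 - z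
    eq = solve-∀

  candidate : ∀ a b c → ∃[ k ] (a ≡ unit k) → ∃[ k ] (b ≡ unit k) → ∃[ k ] (c ≡ unit k) →
    a ≤ b → b ≤ c → a + b + c ≤ 0ℤ → sumOfSquares a b c ≤ + 2 → Candidate (a ∷ b ∷ c ∷ [])
  candidate _ _ _ (i , refl) (j , refl) (k , refl) = units-candidate i j k

  last₁ : ∀ d → 0ℤ ≤ 0ℤ + 0ℤ + 0ℤ + d → Q𝒟 (0ℤ ∷ 0ℤ ∷ 0ℤ ∷ d ∷ []) ≡ + 4 → d ≡ + 2
  last₁ d 0≤L Q≡4 with i*j≡0⇒i≡0∨j≡0 (d - + 2) (trans (eq d) (cong (_- + 4) Q≡4))
    where
    eq : ∀ d → (d - + 2) * (d + + 2) ≡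
      + 2 * (0ℤ * 0ℤ + 0ℤ * 0ℤ + 0ℤ * 0ℤ + d * d) - (0ℤ + 0ℤ + 0ℤ + d) * (0ℤ + 0ℤ + 0ℤ + d) - + 4
    eq = solve-∀
  ... | inj₁ d-2≡0 = i-j≡0⇒i≡j d (+ 2) d-2≡0
  ... | inj₂ d+2≡0 with i-j≡0⇒i≡j d -[1+ 1 ] d+2≡0
  ...   | refl = contradiction 0≤L λ ()

  last₂ : ∀ d → 0ℤ ≤ -1ℤ + 0ℤ + 0ℤ + d → Q𝒟 (-1ℤ ∷ 0ℤ ∷ 0ℤ ∷ d ∷ []) ≡ + 4 → d ≡ 1ℤ
  last₂ d 0≤L Q≡4 with i*j≡0⇒i≡0∨j≡0 (d - 1ℤ) (trans (eq d) (cong (_- + 4) Q≡4))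
    where
    eq : ∀ d → (d - 1ℤ) * (d + + 3) ≡
      + 2 * (-1ℤ * -1ℤ + 0ℤ * 0ℤ + 0ℤ * 0ℤ + d * d) - (-1ℤ + 0ℤ + 0ℤ + d) * (-1ℤ + 0ℤ + 0ℤ + d) - + 4
    eq = solve-∀
  ... | inj₁ d-1≡0 = i-j≡0⇒i≡j d 1ℤ d-1≡0
  ... | inj₂ d+3≡0 with i-j≡0⇒i≡j d -[1+ 2 ] d+3≡0
  ...   | refl = contradiction 0≤L λ ()

  last₃ : ∀ d → 1ℤ ≤ d → Q𝒟 (-1ℤ ∷ 0ℤ ∷ 1ℤ ∷ d ∷ []) ≢ + 4
  last₃ d 1≤d Q≡4 with i*j≡0⇒i≡0∨j≡0 d (trans (eq d) (cong (_- + 4) Q≡4))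
    where
    eq : ∀ d → d * d ≡
      + 2 * (-1ℤ * -1ℤ + 0ℤ * 0ℤ + 1ℤ * 1ℤ + d * d) - (-1ℤ + 0ℤ + 1ℤ + d) * (-1ℤ + 0ℤ + 1ℤ + d) - + 4
    eq = solve-∀
  ... | inj₁ refl = contradiction 1≤d λ { (+≤+ ()) }
  ... | inj₂ refl = contradiction 1≤d λ { (+≤+ ()) }

  complete : ∀ a b c → Candidate (a ∷ b ∷ c ∷ []) → c ≤ d → 0ℤ ≤ a + b + c + d →
    Q𝒟 (a ∷ b ∷ c ∷ d ∷ []) ≡ + 4 → a ∷ b ∷ c ∷ d ∷ [] ≡ e₁ ⊎ a ∷ b ∷ c ∷ d ∷ [] ≡ e₂
  complete _ _ _ (inj₁ refl)        _   0≤L Q≡4 = inj₁ (cong (λ x → 0ℤ ∷ 0ℤ ∷ 0ℤ ∷ x ∷ []) (last₁ d 0≤L Q≡4))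
  complete _ _ _ (inj₂ (inj₁ refl)) _   0≤L Q≡4 = inj₂ (cong (λ x → -1ℤ ∷ 0ℤ ∷ 0ℤ ∷ x ∷ []) (last₂ d 0≤L Q≡4))
  complete _ _ _ (inj₂ (inj₂ refl)) c≤d _   Q≡4 = ⊥-elim (last₃ d c≤d Q≡4)

permute-reverse : ∀ w → permute Perm.reverse w ≡ negate (negReverse w)
permute-reverse (a ∷ b ∷ c ∷ d ∷ []) = lookup-ext λ
  { 0F → sym (neg-involutive d) ; 1F → sym (neg-involutive c)
  ; 2F → sym (neg-involutive b) ; 3F → sym (neg-involutive a) }

Shape : Pred Quadruple 0ℓ
Shape v = ∃[ π ] (permute π v ≡ e₁ ⊎ permute π v ≡ e₁′ ⊎ permute π v ≡ e₂)

shape-permute : ∀ π v → Shape (permute π v) → Shape v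
shape-permute π v (ρ , shape) = ρ ∘ₚ π ,
  subst (λ w → w ≡ e₁ ⊎ w ≡ e₁′ ⊎ w ≡ e₂) (permute-∘ π ρ v) shape

exceptional-shape⁺ : ∀ w → Ordered w → 0ℤ ≤ L w → Q𝒟 w ≡ + 4 → ExceptionalInequality w → Shape w
exceptional-shape⁺ w ordered 0≤L Q≡4 exceptional with exceptional-ordered w ordered 0≤L Q≡4 exceptional
... | inj₁ refl = Perm.id , inj₁ refl
... | inj₂ refl = Perm.id , inj₂ (inj₂ refl)

-- Only `e₁` has a mirror image here: `negReverse w ≡ e₂` would give L = 0, against L < 0.
exceptional-shape⁻ : ∀ w → Ordered w → L w < 0ℤ → Q𝒟 w ≡ + 4 → ExceptionalInequality (negReverse w) → Shape w
exceptional-shape⁻ w ordered L<0 Q≡4 exceptional =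
  [ (λ ≡e₁ → Perm.reverse , inj₂ (inj₁ (trans (permute-reverse w) (cong negate ≡e₁))))
  , (λ ≡e₂ → contradiction (neg-injective (trans (sym (L-negReverse w)) (cong L ≡e₂))) (<⇒≢ L<0)) ]′
  (exceptional-ordered (negReverse w) (ordered-negReverse w ordered)
    (subst (0ℤ ≤_) (sym (L-negReverse w)) (neg-mono-≤ (<⇒≤ L<0)))
    (trans (Q𝒟-negReverse w) Q≡4) exceptional)

exceptional-shape : ∀ {v} → Q𝒟 v ≡ + 4 → IsExceptional v → Shape v
exceptional-shape {v} Q≡4 (_ , π , ordered , inj₁ (0≤L , exceptional)) = shape-permute π v
  (exceptional-shape⁺ (permute π v) ordered 0≤L (trans (Q𝒟-permute π v) Q≡4) exceptional)
exceptional-shape {v} Q≡4 (_ , π , ordered , inj₂ (L<0 , exceptional)) = shape-permute π v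
  (exceptional-shape⁻ (permute π v) ordered L<0 (trans (Q𝒟-permute π v) Q≡4) exceptional)

-- The orbits modulo 4

Congruent : Quadruple → Quadruple → Set
Congruent u w = ∀ i → + 4 ∣ lookup u i - lookup w i

congruent-trans : ∀ {u v w} → Congruent u v → Congruent v w → Congruent u w
congruent-trans {u} {v} {w} u~v v~w i =
  subst (+ 4 ∣_) (eq (lookup u i) (lookup v i) (lookup w i)) (∣m∣n⇒∣m+n (u~v i) (v~w i))
  where
  eq : ∀ x y z → x - y + (y - z) ≡ x - z
  eq = solve-∀

congruent-S : ∀ i u w → Congruent u w → Congruent (S i · u) (S i · w)
congruent-S i u@(a ∷ b ∷ c ∷ d ∷ []) w@(a′ ∷ b′ ∷ c′ ∷ d′ ∷ []) u~w j with j Fin.≟ i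
... | no j≢i   = subst₂ (λ x y → + 4 ∣ x - y) (sym (lookup-S-≢ u j≢i)) (sym (lookup-S-≢ w j≢i)) (u~w j)
... | yes refl = subst₂ (λ x y → + 4 ∣ x - y) (sym (lookup-S i u)) (sym (lookup-S i w))
  (subst (+ 4 ∣_) (eq₁ (L u) (L w) (lookup u i) (lookup w i))
    (∣m∣n⇒∣m-n (∣n⇒∣m*n (+ 2) (subst (+ 4 ∣_) (eq₂ a b c d a′ b′ c′ d′)
      (∣m∣n⇒∣m+n (∣m∣n⇒∣m+n (∣m∣n⇒∣m+n (u~w 0F) (u~w 1F)) (u~w 2F)) (u~w 3F)))) (∣n⇒∣m*n (+ 3) (u~w i))))
  where
  eq₁ : ∀ l m x y → + 2 * (l - m) - + 3 * (x - y) ≡ + 2 * l - + 3 * x - (+ 2 * m - + 3 * y)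
  eq₁ = solve-∀
  eq₂ : ∀ a b c d a′ b′ c′ d′ →
    a - a′ + (b - b′) + (c - c′) + (d - d′) ≡ a + b + c + d - (a′ + b′ + c′ + d′)
  eq₂ = solve-∀

-- The generators act on residue classes, so a class fixed by all four contains the orbit. Modulo 2
-- every rearrangement of `e₁` vanishes; modulo 4 the position of the 2 is still visible.
orbit-congruent : ∀ {e} → (∀ i → Congruent (S i · e) e) → ∀ {w} → w ∈ 𝒜[ e ] → Congruent w e
orbit-congruent {e} fixed w∈ = orbit-induction (λ u → Congruent u e)
  (λ i u u~e → congruent-trans {S i · u} {S i · e} {e} (congruent-S i u e u~e) (fixed i))
  w∈ (λ i → subst (+ 4 ∣_) (sym (+-inverseʳ (lookup e i))) (divides 0ℤ refl))

orbit-congruent₁ : ∀ {w} → w ∈ 𝒜[ e₁ ] → Congruent w e₁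
orbit-congruent₁ = orbit-congruent (from-yes (Fin.all? λ i → Fin.all? λ j →
  + 4 ∣? lookup (S i · e₁) j - lookup e₁ j))

orbit-congruent₂ : ∀ {w} → w ∈ 𝒜[ e₂ ] → Congruent w e₂
orbit-congruent₂ = orbit-congruent (from-yes (Fin.all? λ i → Fin.all? λ j →
  + 4 ∣? lookup (S i · e₂) j - lookup e₂ j))

-- Coordinate `i` of `w` is some entry of `x` congruent to entry `i` of `e`. Testing all pairs of
-- indices thus replaces an enumeration of permutations.
congruent-rigid : ∀ {x e y} → (∀ i j → + 4 ∣ lookup x j - lookup e i → lookup x j ≡ lookup y i) →
  ∀ π w → permute π w ≡ x → Congruent w e → w ≡ y
congruent-rigid {x} {e} {y} determined π w refl w~e = lookup-ext λ i →
  trans (sym (lookup-permute⁻¹ π w i))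
    (determined i (π ⟨$⟩ˡ i) (subst (λ z → + 4 ∣ z - lookup e i) (sym (lookup-permute⁻¹ π w i)) (w~e i)))

incongruent : ∀ {x e} i → (∀ j → ¬ (+ 4 ∣ lookup x j - lookup e i)) →
  ∀ π w → permute π w ≡ x → ¬ Congruent w e
incongruent {x} {e} i impossible π w refl w~e =
  impossible (π ⟨$⟩ˡ i) (subst (λ z → + 4 ∣ z - lookup e i) (sym (lookup-permute⁻¹ π w i)) (w~e i))

determined? : (x e y : Quadruple) → Dec (∀ i j → + 4 ∣ lookup x j - lookup e i → lookup x j ≡ lookup y i)
determined? x e y = Fin.all? λ i → Fin.all? λ j → (+ 4 ∣? lookup x j - lookup e i) →-dec (lookup x j ≟ lookup y i)

incongruent? : (x e : Quadruple) (i : Fin 4) → Dec (∀ j → ¬ (+ 4 ∣ lookup x j - lookup e i))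
incongruent? x e i = Fin.all? λ j → ¬? (+ 4 ∣? lookup x j - lookup e i)

-- The exceptional orbits

reduced? : ∀ v → Dec (Reduced v)
reduced? v = Fin.all? λ i → ¬? (norm (S i · v) ℕ.<? norm v)

e₁′∈ : e₁′ ∈ 𝒜[ e₁ ]
e₁′∈ = S 3F , gen 3F , refl

e₁-exceptional : IsExceptional e₁
e₁-exceptional = from-yes (reduced? e₁) , Perm.id ,
  (≤-refl , ≤-refl , +≤+ ℕ.z≤n) , inj₁ (+≤+ ℕ.z≤n , ≤-refl , +<+ ℕ.z<s)

-- The increasing rearrangement is (-2,0,0,0), whose `negReverse` is `e₁`.
e₁′-exceptional : IsExceptional e₁′
e₁′-exceptional = from-yes (reduced? e₁′) , Perm.reverse ,
  (-≤+ , ≤-refl , ≤-refl) , inj₂ (-<+ , ≤-refl , +<+ ℕ.z<s)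

e₂-exceptional : IsExceptional e₂
e₂-exceptional = from-yes (reduced? e₂) , Perm.id ,
  (-≤+ , ≤-refl , +≤+ ℕ.z≤n) , inj₁ (≤-refl , -≤+ , +<+ ℕ.z<s)

e₁-orbit-exceptional : ExceptionalOrbit 𝒜[ e₁ ]
e₁-orbit-exceptional = zero⇒exceptionalOrbit refl orbit-refl (0F , refl)

e₂-orbit-exceptional : ExceptionalOrbit 𝒜[ e₂ ]
e₂-orbit-exceptional = zero⇒exceptionalOrbit refl orbit-refl (1F , refl)

-- Descent ends at a reduced element; as it cannot be a root, it is exceptional and hence of known
-- shape.
exceptionalOrbit-shape : ∀ {v} → Q𝒟 v ≡ + 4 → ExceptionalOrbit 𝒜[ v ] →
  ∃[ u ] (u ∈ 𝒜[ v ] × Shape u)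
exceptionalOrbit-shape {v} Q≡4 noRoot with reduction v
... | u , u∈ , reduced with reduced-root-or-exceptional u reduced (orbit-Q𝒟 u∈ Q≡4)
...   | inj₁ isRoot      = contradiction (u , u∈ , isRoot) noRoot
...   | inj₂ exceptional = u , u∈ , exceptional-shape (orbit-Q𝒟 u∈ Q≡4) exceptional

exceptionalOrbit⇒zero : ∀ {v} → Q𝒟 v ≡ + 4 → ExceptionalOrbit 𝒜[ v ] →
  ∃[ w ] (w ∈ 𝒜[ v ] × HasZeroCoordinate w)
exceptionalOrbit⇒zero Q≡4 noRoot with exceptionalOrbit-shape Q≡4 noRoot
-- `e₁`, `e₁′` and `e₂` all vanish at `1F`, so `u` vanishes at `π ⟨$⟩ʳ 1F`.
... | u , u∈ , π , shape = u , u∈ , π ⟨$⟩ʳ 1F , trans (sym (lookup-permute π u 1F)) (second shape)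
  where
  second : ∀ {w} → w ≡ e₁ ⊎ w ≡ e₁′ ⊎ w ≡ e₂ → lookup w 1F ≡ 0ℤ
  second (inj₁ refl)        = refl
  second (inj₂ (inj₁ refl)) = refl
  second (inj₂ (inj₂ refl)) = refl

exceptionalOrbit-classification : ∀ {v} → Q𝒟 v ≡ + 4 → ExceptionalOrbit 𝒜[ v ] →
  (𝒜[ v ] ≐ᵖ 𝒜[ e₁ ]) ⊎ (𝒜[ v ] ≐ᵖ 𝒜[ e₂ ])
exceptionalOrbit-classification Q≡4 noRoot with exceptionalOrbit-shape Q≡4 noRoot
... | u , u∈ , π , inj₁ ≡e₁         = inj₁ (orbit-≐ᵖ π u∈ (subst (_∈ 𝒜[ e₁ ]) (sym ≡e₁) orbit-refl))
... | u , u∈ , π , inj₂ (inj₁ ≡e₁′) = inj₁ (orbit-≐ᵖ π u∈ (subst (_∈ 𝒜[ e₁ ]) (sym ≡e₁′) e₁′∈))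
... | u , u∈ , π , inj₂ (inj₂ ≡e₂)  = inj₂ (orbit-≐ᵖ π u∈ (subst (_∈ 𝒜[ e₂ ]) (sym ≡e₂) orbit-refl))

orbits-distinct : ¬ (𝒜[ e₁ ] ≐ᵖ 𝒜[ e₂ ])
-- The entry -1 of `e₂` at `0F` is odd, whereas all entries of `e₁` are even.
orbits-distinct (π , e₁⊆e₂ , _) = incongruent {e = e₂} 0F (from-yes (incongruent? e₁ e₂ 0F))
  (Perm.flip π) (permute π e₁) (permute-flip π e₁) (orbit-congruent₂ (e₁⊆e₂ orbit-refl))

exceptional-in-orbit₁ : (𝒜[ e₁ ] ∩ IsExceptional) ≐ (｛ e₁ ｝ ∪ ｛ e₁′ ｝)
exceptional-in-orbit₁ =
  (λ (w∈ , exceptional) → identify (orbit-congruent₁ w∈) (exceptional-shape (orbit-Q𝒟 w∈ refl) exceptional)) ,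
  λ { (inj₁ refl) → orbit-refl , e₁-exceptional ; (inj₂ refl) → e₁′∈ , e₁′-exceptional }
  where
  identify : ∀ {w} → Congruent w e₁ → Shape w →
    w ∈ ｛ e₁ ｝ ∪ ｛ e₁′ ｝
  identify {w} w~e₁ (π , inj₁ ≡e₁) =
    inj₁ (sym (congruent-rigid {e = e₁} {e₁} (from-yes (determined? e₁ e₁ e₁)) π w ≡e₁ w~e₁))
  identify {w} w~e₁ (π , inj₂ (inj₁ ≡e₁′)) =
    inj₂ (sym (congruent-rigid {e = e₁} {e₁′} (from-yes (determined? e₁′ e₁ e₁′)) π w ≡e₁′ w~e₁))
  identify {w} w~e₁ (π , inj₂ (inj₂ ≡e₂)) =
    -- The entry 2 of `e₁` at `3F` is congruent modulo 4 to none of -1, 0, 1.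
    ⊥-elim (incongruent {e = e₁} 3F (from-yes (incongruent? e₂ e₁ 3F)) π w ≡e₂ w~e₁)

exceptional-in-orbit₂ : (𝒜[ e₂ ] ∩ IsExceptional) ≐ ｛ e₂ ｝
exceptional-in-orbit₂ =
  (λ (w∈ , exceptional) → identify (orbit-congruent₂ w∈) (exceptional-shape (orbit-Q𝒟 w∈ refl) exceptional)) ,
  λ { refl → orbit-refl , e₂-exceptional }
  where
  identify : ∀ {w} → Congruent w e₂ → Shape w →
    w ∈ ｛ e₂ ｝
  identify {w} w~e₂ (π , inj₁ ≡e₁) =
    ⊥-elim (incongruent {e = e₂} 0F (from-yes (incongruent? e₁ e₂ 0F)) π w ≡e₁ w~e₂)
  identify {w} w~e₂ (π , inj₂ (inj₁ ≡e₁′)) =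
    ⊥-elim (incongruent {e = e₂} 0F (from-yes (incongruent? e₁′ e₂ 0F)) π w ≡e₁′ w~e₂)
  identify {w} w~e₂ (π , inj₂ (inj₂ ≡e₂)) =
    sym (congruent-rigid {e = e₂} {e₂} (from-yes (determined? e₂ e₂ e₂)) π w ≡e₂ w~e₂)

theorem3p5 :
  let e₁  = 0ℤ ∷ 0ℤ ∷ 0ℤ ∷ + 2 ∷ []
      e₁′ = 0ℤ ∷ 0ℤ ∷ 0ℤ ∷ -[1+ 1 ] ∷ []
      e₂  = -1ℤ ∷ 0ℤ ∷ 0ℤ ∷ 1ℤ ∷ []
  in
  -- an orbit is exceptional iff it has an element with a zero coordinate
  (∀ v → Q𝒟 v ≡ + 4 →
    ExceptionalOrbit 𝒜[ v ] ⇔ (∃[ w ] w ∈ 𝒜[ v ] × HasZeroCoordinate w))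
  -- the two orbits are exceptional orbits with Q𝒟 = 4, and are distinct
  × (Q𝒟 e₁ ≡ + 4 × ExceptionalOrbit 𝒜[ e₁ ])
  × (Q𝒟 e₂ ≡ + 4 × ExceptionalOrbit 𝒜[ e₂ ])
  × ¬ (𝒜[ e₁ ] ≐ᵖ 𝒜[ e₂ ])
  -- there are no others
  × (∀ v → Q𝒟 v ≡ + 4 → ExceptionalOrbit 𝒜[ v ] →
      (𝒜[ v ] ≐ᵖ 𝒜[ e₁ ]) ⊎ (𝒜[ v ] ≐ᵖ 𝒜[ e₂ ]))
  -- the exceptional quadruples they contain
  × (𝒜[ e₁ ] ∩ IsExceptional) ≐ (｛ e₁ ｝ ∪ ｛ e₁′ ｝)
  × (𝒜[ e₂ ] ∩ IsExceptional) ≐ ｛ e₂ ｝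
theorem3p5 =
  (λ v Q≡4 → mk⇔ (exceptionalOrbit⇒zero Q≡4) (λ (w , w∈ , zeroed) → zero⇒exceptionalOrbit Q≡4 w∈ zeroed)) ,
  (refl , e₁-orbit-exceptional) ,
  (refl , e₂-orbit-exceptional) ,
  orbits-distinct ,
  (λ v → exceptionalOrbit-classification) ,
  exceptional-in-orbit₁ ,
  exceptional-in-orbit₂
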